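{- Let $G$ be a graph. Then $\mathcal Q$ is a parallel increasing path cover of $G$ if and only if $\mathcal Q$ is the chain set of some relaxed chronology $\mathcal F$ of standard forces for some standard zero forcing set $B$ of $G$. Under this correspondence, a collection of block partitions $\{(A_{i,j})_{j=0}^{n_i-1}\}_{i=1}^m$ of $\{0,1,\dots,K\}$ that is a witness that $\mathcal Q$ (with vertices labeled $v_{i,j}$, $1\le i\le m$, $0\le j\le n_i-1$) is a parallel increasing path cover corresponds to a relaxed chronology $\mathcal F=\{F^{(k)}\}_{k=1}^K$ for the standard zero forcing set $\{v_{i,0}\}_{i=1}^m$, with chain set $\mathcal Q$, such that $A_{i,j}=\operatorname{act}_{\mathcal F}(v_{i,j})$ for all $i,j$. That is: for every such witness there is such an $\mathcal F$; and for every relaxed chronology $\mathcal F$ of a standard zero forcing set, with chain set having vertices $v_{i,j}$ labeled in forcing order along the chains, the sets $\operatorname{act}_{\mathcal F}(v_{i,j})$ form a witness that the chain set is a parallel increasing path cover.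
   Context: All graphs are finite, simple and undirected; $\mathbb N$ contains $0$. Standard zero forcing: each vertex is blue or white. A blue vertex $u$ with exactly one white neighbor $v$ can force $v$ to become blue (written $u\to v$). A set $B$ is a standard zero forcing set if, starting with exactly $B$ blue, repeated forcing turns all vertices blue. $S(G,B)$ denotes the set of forces $v\to u$ that are valid when exactly the vertices of $B$ are blue. Relaxed chronology: let $B$ be a standard zero forcing set of $G$ and $\mathcal F=\{F^{(k)}\}_{k=1}^K$ an ordered family of sets of forces ($F^{(k)}=\emptyset$ allowed). Put $E^{[0]}=E^{(0)}=B$, $E^{(k)}=\{u: v\to u\in F^{(k)}\text{ for some }v\}$, $E^{[k]}=\bigcup_{j=0}^kE^{(j)}$. $\mathcal F$ is a relaxed chronology for $B$ if (1) $F^{(k)}\subseteq S(G,E^{[k-1]})$ for all $k$; (2) $v_1\to u,v_2\to u\in F^{(k)}$ implies $v_1=v_2$; (3) $E^{[K]}=V(G)$. The active times $\operatorname{act}_{\mathcal F}(v)$ are those $k\in\{0,\dots,K\}$ such that $v\in E^{[k]}$ and $v$ performs no force in $F^{(1)},\dots,F^{(k)}$. The chain set of $\mathcal F$ is the collection of forcing chains $(v_0,v_1,\dots,v_\ell)$, one for each $v_0\in B$, where $v_{i-1}\to v_i\in\bigcup_kF^{(k)}$ and $v_\ell$ performs no force; each chain is identified with the induced path on its vertices. A path cover of $G$ is a collection of induced paths of $G$ such that each vertex is in exactly one path. A block partition of $\{0,\dots,K\}$ is a partition $(A_0,\dots,A_{n-1})$ of it into nonempty parts such that $j_1<j_2$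 implies every element of $A_{j_1}$ is less than every element of $A_{j_2}$. Parallel increasing path cover (PIP): a path cover $\mathcal Q=\{Q_i\}_{i=1}^m$ of $G$, with $n_i=|V(Q_i)|$ and the vertices of $Q_i$ labeled $v_{i,0},\dots,v_{i,n_i-1}$ in path order (so $v_{i,j_1}v_{i,j_2}\in E(G)$ iff $|j_1-j_2|=1$), for which there exist $K\in\mathbb N$ and, for each $i$, a block partition $(A_{i,j})_{j=0}^{n_i-1}$ of $\{0,\dots,K\}$ such that for $i_1\neq i_2$, $v_{i_1,j_1}v_{i_2,j_2}\in E(G)$ implies $A_{i_1,j_1}\cap A_{i_2,j_2}\ne\emptyset$. Such a collection of block partitions is called a witness that $\mathcal Q$ is a PIP. -}

module Defs where

open import Level using (0ℓ)
open import Data.Nat using (ℕ; zero; suc; ∣_-_∣)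
open import Data.Fin using (Fin; zero; suc; toℕ; fromℕ; inject₁; _≤_; _<_)
open import Data.Product using (Σ; Σ-syntax; ∃; ∃-syntax; ∃!; _×_)
open import Function.Bundles using (_⇔_)
open import Function.Definitions using (Injective)
open import Relation.Binary using (Rel; Symmetric; Irreflexive; Decidable; _⇒_)
open import Relation.Binary.PropositionalEquality using (_≡_; _≢_)
open import Relation.Nullary using (¬_)
open import Relation.Unary using (Pred; _∈_; _∉_; _∪_; ｛_｝; _≐_; _≬_; Satisfiable; Universal)

-- Sets of vertices and of times are predicates on Fin.

record Graph (n : ℕ) : Set₁ where
  field
    Adj       : Rel (Fin n) 0ℓ
    symmetric : Symmetric Adj
    loopless  : Irreflexive _≡_ Adj
    adj?      : Decidable Adj

VertexSet : ℕ → Set₁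
VertexSet n = Pred (Fin n) 0ℓ

-- For F : ForceSet n, F v u means that v → u belongs to F.
ForceSet : ℕ → Set₁
ForceSet n = Rel (Fin n) 0ℓ

-- m nonempty sequences of vertices; the i-th has n_i = suc (last i) entries,
-- v_{i,j} = at i j for 0 ≤ j ≤ last i.
record Rows (n m : ℕ) : Set where
  field
    last : Fin m → ℕ
    at   : (i : Fin m) → Fin (suc (last i)) → Fin n

-- An induced path is determined by its vertex set, so a collection
-- {Q_i} of (undirected) induced paths is a family of vertex sets.
Collection : ℕ → ℕ → Set₁
Collection n m = Fin m → VertexSet n

range : ∀ {n ℓ} → (Fin (suc ℓ) → Fin n) → VertexSet n
range w x = ∃[ j ] w j ≡ x

-- Fin (suc K) is {0,…,K}.
TimeSet : ℕ → Set₁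
TimeSet K = Pred (Fin (suc K)) 0ℓ

record IsBlockPartition {K N : ℕ} (A : Fin N → TimeSet K) : Set where
  field
    nonempty  : ∀ j → Satisfiable (A j)
    partition : ∀ k → ∃! _≡_ λ j → k ∈ A j
    ordered   : ∀ {j₁ j₂} → j₁ < j₂ → ∀ {k₁ k₂} → k₁ ∈ A j₁ → k₂ ∈ A j₂ → k₁ < k₂

-- F k is the set F^{(k+1)}, so Fin K indexes F^{(1)},…,F^{(K)}.
ForceFamily : ℕ → ℕ → Set₁
ForceFamily n K = Fin K → ForceSet n

module _ {n K : ℕ} (B : VertexSet n) (F : ForceFamily n K) where

  -- E^{(k)}
  E⁽_⁾ : Fin (suc K) → VertexSet n
  E⁽ zero ⁾  = B
  E⁽ suc k ⁾ = λ u → ∃[ v ] F k v u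

  -- E^{[k]}
  E[_] : Fin (suc K) → VertexSet n
  E[ k ] = λ u → ∃[ j ] j ≤ k × u ∈ E⁽ j ⁾

  act : Fin n → TimeSet K
  act v k = v ∈ E[ k ] × (∀ j → suc j ≤ k → ∀ u → ¬ F j v u)

  record IsChain {ℓ : ℕ} (w : Fin (suc ℓ) → Fin n) : Set where
    field
      starts : w zero ∈ B
      forces : ∀ (j : Fin ℓ) → ∃[ k ] F k (w (inject₁ j)) (w (suc j))
      stops  : ∀ k u → ¬ F k (w (fromℕ ℓ)) u

  -- Q is the chain set, and R lists the vertices of each member in forcing order.
  record IsLabelledChainSet {m : ℕ} (Q : Collection n m) (R : Rows n m) : Set where
    open Rows R
    field
      chains      : ∀ i → IsChain (at i)
      one-each : ∀ v₀ → v₀ ∈ B → ∃! _≡_ λ i → at i zero ≡ v₀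
      vertices    : ∀ i → Q i ≐ range (at i)

  IsChainSet : {m : ℕ} → Collection n m → Set
  IsChainSet {m} Q = Σ[ R ∈ Rows n m ] IsLabelledChainSet Q R

module _ {n : ℕ} (G : Graph n) where
  open Graph G

  record IsPathOrder (P : VertexSet n) {ℓ : ℕ} (w : Fin (suc ℓ) → Fin n) : Set where
    field
      injective : Injective _≡_ _≡_ w
      vertices  : P ≐ range w
      adjacency : ∀ j₁ j₂ → Adj (w j₁) (w j₂) ⇔ ∣ toℕ j₁ - toℕ j₂ ∣ ≡ 1

  IsInducedPath : VertexSet n → Set
  IsInducedPath P = ∃[ ℓ ] Σ[ w ∈ (Fin (suc ℓ) → Fin n) ] IsPathOrder P w

  record IsPathCover {m : ℕ} (Q : Collection n m) : Set where
    field
      paths  : ∀ i → IsInducedPath (Q i)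
      covers : ∀ x → ∃! _≡_ λ i → x ∈ Q i

  IsLabelling : {m : ℕ} → Collection n m → Rows n m → Set
  IsLabelling Q R = ∀ i → IsPathOrder (Q i) (Rows.at R i)

  record IsWitness {m : ℕ} (R : Rows n m) (K : ℕ)
                   (A : (i : Fin m) → Fin (suc (Rows.last R i)) → TimeSet K) : Set where
    open Rows R
    field
      blocks : ∀ i → IsBlockPartition (A i)
      meets  : ∀ {i₁ i₂} → i₁ ≢ i₂ → ∀ j₁ j₂ →
               Adj (at i₁ j₁) (at i₂ j₂) → A i₁ j₁ ≬ A i₂ j₂

  -- The direction in which each path is labelled is part of what has to be found.
  IsPIP : {m : ℕ} → Collection n m → Set₁
  IsPIP {m} Q =
    IsPathCover Q ×
    (Σ[ R ∈ Rows n m ] IsLabelling Q R ×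
      (∃[ K ] Σ[ A ∈ ((i : Fin m) → Fin (suc (Rows.last R i)) → TimeSet K) ]
        IsWitness R K A))

  -- S(G,B)
  record S (B : VertexSet n) (v u : Fin n) : Set where
    field
      blue     : v ∈ B
      adjacent : Adj v u
      white    : u ∉ B
      only     : ∀ w → Adj v w → w ∉ B → w ≡ u

  -- Some sequence of valid single forces starting from B turns all vertices blue.
  data IsZeroForcing (B : VertexSet n) : Set where
    done  : Universal B → IsZeroForcing B
    force : ∀ {v u} → S B v u → IsZeroForcing (B ∪ ｛ u ｝) → IsZeroForcing B

  record IsRelaxedChronology {K : ℕ} (B : VertexSet n) (F : ForceFamily n K) : Set where
    field
      valid  : ∀ k → F k ⇒ S (E[_] B F (inject₁ k))
      unique : ∀ k {v₁ v₂ u} → F k v₁ u → F k v₂ u → v₁ ≡ v₂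
      full   : Universal (E[_] B F (fromℕ K))

-- {v_{i,0}}
starts : ∀ {n m} → Rows n m → VertexSet n
starts R x = ∃[ i ] Rows.at R i zero ≡ x

{-# OPTIONS --safe #-}

-- In a relaxed chronology every vertex turns blue at exactly one time and forces at
-- most one vertex, strictly later.  So times increase along the forcing chains, and
-- v_{i,j} is active from its own time until just before the time of v_{i,j+1}: the
-- active times along a chain are consecutive blocks.  An edge between different chains
-- is never a force, so the endpoint that turns blue first must still be active when the
-- other one does.  Conversely, given a witness, let v_{i,j} force v_{i,j+1} at the first
-- time in A_{i,j+1}.  A neighbour of v_{i,j} on another path shares a time with it, and
-- hence is blue when the force happens.

module Submission where

open import Data.Nat using (ℕ; zero; suc; z≤n; s≤s; s≤s⁻¹; ∣_-_∣)
import Data.Nat as ℕ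
import Data.Nat.Properties as ℕ
open import Data.Fin using (Fin; zero; suc; toℕ; fromℕ; inject₁; _≤_; _<_; _>_; _≤?_; _≟_)
open import Data.Fin.Properties
  using (≤-refl; ≤-reflexive; ≤-trans; ≤-antisym; ≤-total; <-trans; <-irrefl; <-cmp; ≤∧≢⇒<;
         toℕ-inject₁; toℕ-injective; ≤fromℕ; fromℕ≢inject₁; suc-injective; any?)
open import Data.Fin.Induction
  using (<-weakInduction; >-weakInduction; <-wellFounded; >-wellFounded; Acc; acc)
open import Data.Fin.Relation.Unary.Top using (View; view; ‵fromℕ; ‵inject₁)
open import Data.List using (List; []; _∷_; lookup; filter; length; allFin)
open import Data.List.Membership.Propositional using () renaming (_∈_ to _∈ˡ_)
open import Data.List.Membership.Propositional.Properties
  using (∈-allFin; ∈-filter⁺; ∈-filter⁻; ∈-lookup)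
open import Data.List.Relation.Unary.All as All using ()
open import Data.List.Relation.Unary.AllPairs using (_∷_)
open import Data.List.Relation.Unary.Any using (here; there; index)
open import Data.List.Relation.Unary.Any.Properties using (lookup-index)
open import Data.List.Relation.Unary.Unique.Propositional using (Unique)
open import Data.List.Relation.Unary.Unique.Propositional.Properties using (allFin⁺; filter⁺)
open import Data.Product using (Σ-syntax; ∃₂; ∃-syntax; _×_; _,_; proj₁; proj₂)
open import Data.Sum using (_⊎_; inj₁; inj₂; fromInj₂)
open import Data.Vec.Functional using () renaming (_∷_ to _◁_)
open import Function using (_∘_)
open import Function.Bundles using (_⇔_; mk⇔; Equivalence)
open import Relation.Binary using (Tri; tri<; tri≈; tri>)
open import Relation.Binary.PropositionalEquality
  using (_≡_; _≢_; refl; sym; trans; cong; subst; subst₂)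
open import Relation.Nullary using (¬_; Dec; yes; no; contradiction)
open import Relation.Nullary.Decidable using (_⊎-dec_)
open import Relation.Unary using (Decidable; _∈_; _⊆_; _≐_; _≬_; _∪_; ｛_｝)
open import Defs

-- Order lemmas for finite indices

module _ {m n : ℕ} {i : Fin m} {j : Fin n} where

  <suc⇒≤inject₁ : i < suc j → i ≤ inject₁ j
  <suc⇒≤inject₁ (s≤s p) = subst (toℕ i ℕ.≤_) (sym (toℕ-inject₁ j)) p

  ≤inject₁⇒<suc : i ≤ inject₁ j → i < suc j
  ≤inject₁⇒<suc p = s≤s (subst (toℕ i ℕ.≤_) (toℕ-inject₁ j) p)

  inject₁<⇒suc≤ : inject₁ i < j → suc i ≤ j
  inject₁<⇒suc≤ = subst (λ x → suc x ℕ.≤ toℕ j) (toℕ-inject₁ i)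

  suc≤⇒inject₁< : suc i ≤ j → inject₁ i < j
  suc≤⇒inject₁< = subst (λ x → suc x ℕ.≤ toℕ j) (sym (toℕ-inject₁ i))

inject₁<suc : ∀ {n} (i : Fin n) → inject₁ i < suc i
inject₁<suc i = suc≤⇒inject₁< {i = i} {j = suc i} ℕ.≤-refl

stepwise-monotone : ∀ {N M} (f : Fin (suc N) → Fin M) →
  (∀ j → f (inject₁ j) < f (suc j)) → ∀ {i j} → i < j → f i < f j
stepwise-monotone f step {i} {j} = <-weakInduction (λ j → i < j → f i < f j) (λ ()) next j
  where
  next : ∀ j → (i < inject₁ j → f i < f (inject₁ j)) → i < suc j → f i < f (suc j)
  next j ih i<1+j with i ≟ inject₁ j
  ... | yes refl = step j
  ... | no i≢j   = <-trans (ih (≤∧≢⇒< (<suc⇒≤inject₁ i<1+j) i≢j)) (step j)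

lookup-injective : ∀ {A : Set} {xs : List A} → Unique xs →
  ∀ i j → lookup xs i ≡ lookup xs j → i ≡ j
lookup-injective (_ ∷ _) zero zero _ = refl
lookup-injective {xs = _ ∷ xs} (x∉ ∷ _) zero (suc j) eq =
  contradiction eq (All.lookup x∉ (∈-lookup {xs = xs} j))
lookup-injective {xs = _ ∷ xs} (x∉ ∷ _) (suc i) zero eq =
  contradiction (sym eq) (All.lookup x∉ (∈-lookup {xs = xs} i))
lookup-injective (_ ∷ u) (suc i) (suc j) eq = cong suc (lookup-injective u i j eq)

distance-one : ∀ {N} {i j : Fin N} → i < j → ∣ toℕ i - toℕ j ∣ ≡ 1 → toℕ j ≡ suc (toℕ i)
distance-one {i = i} {j} i<j d =
  trans (sym (ℕ.m∸n+n≡m (ℕ.<⇒≤ i<j)))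
    (cong (ℕ._+ toℕ i) (trans (sym (ℕ.m≤n⇒∣m-n∣≡n∸m (ℕ.<⇒≤ i<j))) d))

successive : ∀ {N} {i j : Fin N} → toℕ j ≡ suc (toℕ i) → ∣ toℕ i - toℕ j ∣ ≡ 1
successive {i = i} eq rewrite eq = trans (ℕ.m≤n⇒∣m-n∣≡n∸m (ℕ.n≤1+n (toℕ i))) (ℕ.m+n∸n≡m 1 (toℕ i))

-- Induced paths from vertex sequences

module _ {n : ℕ} (G : Graph n) where
  open Graph G

  -- Adjacency and distance are both symmetric, so only increasing pairs matter: `chordless` gives
  -- one implication there, and consecutive edges give the other.
  induced-adjacency : ∀ {ℓ} (w : Fin (suc ℓ) → Fin n) →
    (∀ j → Adj (w (inject₁ j)) (w (suc j))) →
    (∀ {j₁ j₂} → j₁ < j₂ → Adj (w j₁) (w j₂) → toℕ j₂ ≡ suc (toℕ j₁)) →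
    ∀ j₁ j₂ → Adj (w j₁) (w j₂) ⇔ ∣ toℕ j₁ - toℕ j₂ ∣ ≡ 1
  induced-adjacency w edge chordless j₁ j₂ = by-cases (<-cmp j₁ j₂)
    where
    edge′ : ∀ i j → toℕ j ≡ suc (toℕ i) → Adj (w i) (w j)
    edge′ i (suc j) eq
      with refl ← toℕ-injective {i = i} {j = inject₁ j}
                    (trans (sym (ℕ.suc-injective eq)) (sym (toℕ-inject₁ j))) = edge j

    by-cases : Tri (j₁ < j₂) (j₁ ≡ j₂) (j₂ < j₁) → Adj (w j₁) (w j₂) ⇔ ∣ toℕ j₁ - toℕ j₂ ∣ ≡ 1
    by-cases (tri< j₁<j₂ _ _) = mk⇔
      (successive ∘ chordless j₁<j₂) (edge′ j₁ j₂ ∘ distance-one j₁<j₂)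
    by-cases (tri≈ _ refl _) = mk⇔ (λ a → contradiction a (loopless refl))
      (λ d → contradiction (trans (sym (ℕ.∣n-n∣≡0 (toℕ j₁))) d) λ ())
    by-cases (tri> _ _ j₂<j₁) = mk⇔
      (trans swap ∘ successive ∘ chordless j₂<j₁ ∘ symmetric)
      (symmetric ∘ edge′ j₂ j₁ ∘ distance-one j₂<j₁ ∘ trans (sym swap))
      where
      swap : ∣ toℕ j₁ - toℕ j₂ ∣ ≡ ∣ toℕ j₂ - toℕ j₁ ∣
      swap = ℕ.∣-∣-comm (toℕ j₁) (toℕ j₂)


-- Relaxed chronologies: the time at which each vertex turns blue

module FromChronology {n K : ℕ} (G : Graph n) (B : VertexSet n) (F : ForceFamily n K)
                      (chronology : IsRelaxedChronology G B F) where
  open Graph G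
  open IsRelaxedChronology chronology

  E : Fin (suc K) → VertexSet n
  E = E[_] B F

  E-monotone : ∀ {k l} → k ≤ l → E k ⊆ E l
  E-monotone k≤l (j , j≤k , e) = j , ≤-trans j≤k k≤l , e

  private
    -- A forced vertex is white until its force, so it lies in no earlier E^{[k]}.
    earliest : ∀ {x} j k → x ∈ E⁽_⁾ B F j → x ∈ E k → j ≤ k
    earliest zero    k _       _  = z≤n
    earliest (suc j) k (v , f) x∈ with suc j ≤? k
    ... | yes p = p
    ... | no ¬p = contradiction (E-monotone {k} {inject₁ j} (<suc⇒≤inject₁ (ℕ.≰⇒> ¬p)) x∈)
                                (S.white (valid j f))

  -- `full` merely supplies some index with `x` in E^{(k)}; by `time-unique` there is no other
  -- choice.
  time : Fin n → Fin (suc K)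
  time x = proj₁ (full x)

  at-time : ∀ x → x ∈ E⁽_⁾ B F (time x)
  at-time x = proj₂ (proj₂ (full x))

  ∈E⁺ : ∀ {x k} → time x ≤ k → x ∈ E k
  ∈E⁺ {x} p = time x , p , at-time x

  ∈E⁻ : ∀ {x} k → x ∈ E k → time x ≤ k
  ∈E⁻ {x} k = earliest (time x) k (at-time x)

  time-unique : ∀ {x} j → x ∈ E⁽_⁾ B F j → time x ≡ j
  time-unique {x} j e =
    ≤-antisym (∈E⁻ j (j , ≤-refl , e)) (earliest j (time x) e (∈E⁺ ≤-refl))

  force-time : ∀ {k v u} → F k v u → time u ≡ suc k
  force-time {k} f = time-unique (suc k) (_ , f)

  forcer-time : ∀ {k v u} → F k v u → time v ≤ inject₁ k
  forcer-time {k} f = ∈E⁻ (inject₁ k) (S.blue (valid k f))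

  force-increases : ∀ {k v u} → F k v u → time v < time u
  force-increases f = subst (time _ <_) (sym (force-time f)) (≤inject₁⇒<suc (forcer-time f))

  -- Since `F k` is step k+1, acting on E^{[k]}, the bound `k < time w` means that `w` is still
  -- white when the force happens.
  force-only : ∀ {k v u w} → F k v u → Adj v w → k < time w → w ≡ u
  force-only {k} {w = w} f a k<w = S.only (valid k f) w a λ w∈ →
    ℕ.<-irrefl refl (ℕ.≤-trans k<w (subst (toℕ (time w) ℕ.≤_) (toℕ-inject₁ k) (∈E⁻ _ w∈)))

  -- A vertex turns blue only once, so both forces belong to the same step, where `unique` applies.
  forcer-unique : ∀ {k l v w u} → F k v u → F l w u → v ≡ w
  forcer-unique {k} f g with refl ← trans (sym (force-time f)) (force-time g) = unique k f g

  -- When the earlier of the two forces happens, the target of the other is still a white neighbor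
  -- of `v`.
  target-unique : ∀ {k l v u x} → F k v u → F l v x → u ≡ x
  target-unique {k} {l} f g with ≤-total k l
  ... | inj₁ k≤l = sym (force-only f (S.adjacent (valid l g))
                     (subst (k <_) (sym (force-time g)) (s≤s k≤l)))
  ... | inj₂ l≤k = force-only g (S.adjacent (valid k f))
                     (subst (l <_) (sym (force-time f)) (s≤s l≤k))

  initial-unforced : ∀ {k v u} → u ∈ B → ¬ F k v u
  initial-unforced u∈B f with () ← trans (sym (time-unique zero u∈B)) (force-time f)

  -- Decidability, single forces and forcing chains

  B? : Decidable B
  B? x with time x | at-time x
  ... | zero  | x∈B     = yes x∈B
  ... | suc _ | (_ , f) = no λ x∈B → initial-unforced x∈B f

  -- `at-time u` either puts `u` in `B` or exhibits a force into `u`. That force is the only one, so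
  -- comparing step and forcer with it decides the question.
  F? : ∀ k v u → Dec (F k v u)
  F? k v u = by-cases (time u) (at-time u)
    where
    by-cases : ∀ j → u ∈ E⁽_⁾ B F j → Dec (F k v u)
    by-cases zero    u∈B     = no (initial-unforced u∈B)
    by-cases (suc l) (x , g) with k ≟ l | v ≟ x
    ... | yes refl | yes refl = yes g
    ... | no k≢l   | _        = no λ f → k≢l (suc-injective (trans (sym (force-time f)) (force-time g)))
    ... | _        | no v≢x   = no λ f → v≢x (forcer-unique f g)

  -- The forces of one step become single forces one at a time: a force stays valid in a
  -- larger blue set as long as its target is white.
  zero-forcing : IsZeroForcing G B
  zero-forcing = from zero B? λ { (zero , _ , b) → b }
    where
    -- The blue set `X` is any decidable superset of E^{[k]}, because single forces produce iterated
    -- unions that agree with E^{[k]} only up to inclusion.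
    Completes : Fin (suc K) → Set₁
    Completes k = ∀ {X} → Decidable X → E k ⊆ X → IsZeroForcing G X

    -- Invariant: `X` contains everything blue before the step, and each vertex blue after it is in
    -- `X` or still waiting in `xs`.
    sweep : ∀ k → Completes (suc k) → (xs : List (Fin n)) → ∀ {X} → Decidable X →
      E (inject₁ k) ⊆ X → (∀ {x} → x ∈ E (suc k) → x ∈ˡ xs ⊎ x ∈ X) → IsZeroForcing G X
    sweep k next [] X? _ new = next X? λ x∈ → fromInj₂ (λ ()) (new x∈)
    sweep k next (u ∷ xs) {X} X? old new with X? u | any? (λ v → F? k v u)
    ... | yes u∈X | _ = sweep k next xs X? old skip
      where
      skip : ∀ {x} → x ∈ E (suc k) → x ∈ˡ xs ⊎ x ∈ X
      skip x∈ with new x∈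
      ... | inj₁ (here refl) = inj₂ u∈X
      ... | inj₁ (there p)   = inj₁ p
      ... | inj₂ p           = inj₂ p
    ... | no u∉X | yes (v , f) =
      force (record
        { blue     = old (S.blue (valid k f))
        ; adjacent = S.adjacent (valid k f)
        ; white    = u∉X
        ; only     = λ w a w∉X → S.only (valid k f) w a (w∉X ∘ old)
        })
        (sweep k next xs (λ x → X? x ⊎-dec u ≟ x) (inj₁ ∘ old) add)
      where
      add : ∀ {x} → x ∈ E (suc k) → x ∈ˡ xs ⊎ x ∈ X ∪ ｛ u ｝
      add x∈ with new x∈
      ... | inj₁ (here refl) = inj₂ (inj₂ refl)
      ... | inj₁ (there p)   = inj₁ p
      ... | inj₂ p           = inj₂ (inj₁ p)
    ... | no u∉X | no unforced = sweep k next xs X? old skip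
      where
      skip : ∀ {x} → x ∈ E (suc k) → x ∈ˡ xs ⊎ x ∈ X
      skip x∈@(j , j≤ , e) with new x∈
      ... | inj₁ (there p) = inj₁ p
      ... | inj₂ p         = inj₂ p
      -- Nothing forces this vertex in the current step, so it was blue before and lies in `X`.
      ... | inj₁ (here refl) with j ≟ suc k
      ...   | yes refl = contradiction e unforced
      ...   | no j≢    = inj₂ (old (j , <suc⇒≤inject₁ (≤∧≢⇒< j≤ j≢) , e))

    from : ∀ k → Completes k
    -- Downward induction on the step: at time K all vertices are blue already.
    from = >-weakInduction Completes (λ _ E⊆X → done (λ x → E⊆X (full x)))
      λ k next X? old → sweep k next (allFin n) X? old (λ _ → inj₁ (∈-allFin _))

  -- Each force leads to a vertex with a strictly later time, and times are at most K, so following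
  -- forces from `v` ends.
  chain-from : ∀ v → ∃[ ℓ ] Σ[ w ∈ (Fin (suc ℓ) → Fin n) ] w zero ≡ v ×
    (∀ j → ∃[ k ] F k (w (inject₁ j)) (w (suc j))) × (∀ k u → ¬ F k (w (fromℕ ℓ)) u)
  chain-from v = go v (>-wellFounded (time v))
    where
    go : ∀ v → Acc _>_ (time v) → ∃[ ℓ ] Σ[ w ∈ (Fin (suc ℓ) → Fin n) ] w zero ≡ v ×
      (∀ j → ∃[ k ] F k (w (inject₁ j)) (w (suc j))) × (∀ k u → ¬ F k (w (fromℕ ℓ)) u)
    go v (acc later) with any? (λ u → any? (λ k → F? k v u))
    ... | no stops = 0 , (λ _ → v) , refl , (λ ()) , λ k u f → stops (u , k , f)
    ... | yes (u , k , f) with go u (later (force-increases f))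
    ...   | ℓ , w , refl , forces , stops =
      suc ℓ , (v ◁ w) , refl , (λ { zero → k , f ; (suc j) → forces j }) , stops

  -- Listing `B` without repetition makes the list indices correspond exactly to the starting
  -- vertices, which is what `one-each` asks for.
  chain-set : ∃[ m ] Σ[ Q ∈ Collection n m ] IsChainSet B F Q
  chain-set = length initial , (λ i → range (Rows.at R i)) , R , record
    { chains = λ i → let _ , _ , start , forces , stops = chain-from (lookup initial i) in record
        { starts = subst B (sym start) (proj₂ (∈-filter⁻ B? {xs = allFin n} (∈-lookup {xs = initial} i)))
        ; forces = forces
        ; stops  = stops
        }
    ; one-each = λ v v∈B → let v∈ = ∈-filter⁺ B? (∈-allFin v) v∈B in
        index v∈ , trans (start (index v∈)) (sym (lookup-index v∈)) ,
        λ {i} eq → lookup-injective distinct (index v∈) i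
          (trans (sym (lookup-index v∈)) (trans (sym eq) (start i)))
    ; vertices = λ i → (λ x → x) , (λ x → x)
    }
    where
    initial : List (Fin n)
    initial = filter B? (allFin n)

    distinct : Unique initial
    distinct = filter⁺ B? (allFin⁺ n)

    R : Rows n (length initial)
    R = record
      { last = λ i → proj₁ (chain-from (lookup initial i))
      ; at   = λ i → proj₁ (proj₂ (chain-from (lookup initial i)))
      }

    start : ∀ i → Rows.at R i zero ≡ lookup initial i
    start i = proj₁ (proj₂ (proj₂ (chain-from (lookup initial i))))

  -- Bounds on active times

  acts-when-blue : ∀ v → time v ∈ act B F v
  acts-when-blue v = ∈E⁺ ≤-refl , λ j j<v u f →
    ℕ.<-irrefl refl (ℕ.≤-trans (suc≤⇒inject₁< {j = time v} j<v) (forcer-time f))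

  acts-until-force : ∀ {v u l} {k : Fin (suc K)} → F l v u → k ∈ act B F v → k < time u
  acts-until-force {l = l} {k} f (_ , idle) =
    subst (k <_) (sym (force-time f)) (ℕ.≰⇒> λ l<k → idle l l<k _ f)

  -- Had `a` forced by the time `b` turned blue, `b` would have been a white neighbor of `a` just
  -- before that force, hence its target.
  acts-at-later-blue : ∀ {a b} → Adj a b → (∀ k → ¬ F k a b) → time a ≤ time b → time b ∈ act B F a
  acts-at-later-blue {a} {b} adj unforced a≤b = ∈E⁺ a≤b , λ j j<b u f →
    unforced j (subst (F j a) (sym (force-only f adj j<b)) f)

  -- The chain set is a path cover

  module Chains {m : ℕ} (Q : Collection n m) (R : Rows n m)
                (labelled : IsLabelledChainSet B F Q R) where
    open Rows R
    open IsLabelledChainSet labelled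

    forces : ∀ i (j : Fin (last i)) → ∃[ k ] F k (at i (inject₁ j)) (at i (suc j))
    forces i = IsChain.forces (chains i)

    -- Forces never leave a chain: the last vertex performs none, and any other vertex has only its
    -- successor as target.
    position-of-force : ∀ {k i u} j → F k (at i j) u → ∃[ j′ ] j ≡ inject₁ j′ × u ≡ at i (suc j′)
    position-of-force {i = i} j f with view j
    ... | ‵fromℕ     = contradiction f (IsChain.stops (chains i) _ _)
    ... | ‵inject₁ j = j , refl , target-unique f (proj₂ (forces i j))

    -- Trace forces back to `B`. The forcer of `x` turned blue earlier, so it lies on a chain by
    -- induction, and `x` is the next vertex there.
    located : ∀ x → ∃₂ λ i j → at i j ≡ x
    located x = go x (<-wellFounded (time x))
      where
      go : ∀ x → Acc _<_ (time x) → ∃₂ λ i j → at i j ≡ x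
      go x (acc earlier) with B? x
      ... | yes x∈B = let i , eq , _ = one-each x x∈B in i , zero , eq
      ... | no x∉B with time x | at-time x
      ...   | zero  | x∈B     = contradiction x∈B x∉B
      ...   | suc k | (v , f) with go v (earlier (subst (time v <_) (force-time f) (force-increases f)))
      ...     | i , j , refl with position-of-force j f
      ...       | j′ , _ , u≡ = i , suc j′ , sym u≡

    -- Walk back along both chains: equal vertices have equal forcers. A vertex of `B` is never
    -- forced, so both walks reach their starts together, and `one-each` identifies the chains.
    same-chain : ∀ {i i′} j j′ → at i j ≡ at i′ j′ → i ≡ i′
    same-chain {i} {i′} = <-weakInduction (λ j → ∀ j′ → at i j ≡ at i′ j′ → i ≡ i′) base step
      where
      starts∈B : ∀ i → at i zero ∈ B
      starts∈B i = IsChain.starts (chains i)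

      base : ∀ j′ → at i zero ≡ at i′ j′ → i ≡ i′
      base zero eq =
        let _ , _ , only = one-each (at i zero) (starts∈B i) in trans (sym (only refl)) (only (sym eq))
      base (suc j′) eq = contradiction (proj₂ (forces i′ j′)) (initial-unforced (subst B eq (starts∈B i)))

      step : ∀ j → (∀ j′ → at i (inject₁ j) ≡ at i′ j′ → i ≡ i′) →
             ∀ j′ → at i (suc j) ≡ at i′ j′ → i ≡ i′
      step j ih zero eq =
        contradiction (proj₂ (forces i j)) (initial-unforced (subst B (sym eq) (starts∈B i′)))
      step j ih (suc j′) eq = let k , f = forces i j in
        ih (inject₁ j′) (forcer-unique (subst (F k _) eq f) (proj₂ (forces i′ j′)))

    times-increase : ∀ i {j₁ j₂} → j₁ < j₂ → time (at i j₁) < time (at i j₂)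
    times-increase i = stepwise-monotone (time ∘ at i) (λ j → force-increases (proj₂ (forces i j)))

    times-increase-≤ : ∀ i {j₁ j₂} → j₁ ≤ j₂ → time (at i j₁) ≤ time (at i j₂)
    times-increase-≤ i {j₁} {j₂} j₁≤j₂ with j₁ ≟ j₂
    ... | yes refl = ≤-refl
    ... | no j₁≢j₂ = ℕ.<⇒≤ (times-increase i (≤∧≢⇒< j₁≤j₂ j₁≢j₂))

    at-injective : ∀ i {j₁ j₂} → at i j₁ ≡ at i j₂ → j₁ ≡ j₂
    at-injective i {j₁} {j₂} eq with <-cmp j₁ j₂
    ... | tri< lt _ _ = contradiction (times-increase i lt) (<-irrefl (cong time eq))
    ... | tri≈ _ j≡ _ = j≡
    ... | tri> _ _ gt = contradiction (times-increase i gt) (<-irrefl (cong time (sym eq)))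

    -- When a chain vertex forces its successor, all later vertices of the chain are still white, so
    -- the successor is its only neighbor among them.
    chordless : ∀ i {j₁ j₂} → j₁ < j₂ → Adj (at i j₁) (at i j₂) → toℕ j₂ ≡ suc (toℕ j₁)
    chordless i {j₁} {j₂} j₁<j₂ adj with view j₁
    ... | ‵fromℕ     = contradiction (≤fromℕ j₂) (ℕ.<⇒≱ j₁<j₂)
    ... | ‵inject₁ j = let k , f = forces i j in
      trans (cong toℕ (at-injective i (force-only f adj
        (subst (_≤ time (at i j₂)) (force-time f)
          (times-increase-≤ i {suc j} (inject₁<⇒suc≤ {j = j₂} j₁<j₂))))))
        (cong suc (sym (toℕ-inject₁ j)))

    labelling : IsLabelling G Q R
    labelling i = record
      { injective = at-injective i
      ; vertices  = vertices i
      ; adjacency = induced-adjacency G (at i)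
          (λ j → let k , f = forces i j in S.adjacent (valid k f)) (chordless i)
      }

    path-cover : IsPathCover G Q
    path-cover = record
      { paths  = λ i → last i , at i , labelling i
      ; covers = λ x → let i , j , at≡x = located x in
          i , proj₂ (vertices i) (j , at≡x) , λ x∈Q →
            let j′ , at≡x′ = proj₁ (vertices _) x∈Q in same-chain j j′ (trans at≡x (sym at≡x′))
      }

    -- Active times form a witness

    Act : ∀ i → Fin (suc (last i)) → TimeSet K
    Act i j = act B F (at i j)

    -- The force from `at i j₁` to its successor separates the two times: it ends the first
    -- activity, and `at i j₂` turns blue no earlier than that successor.
    act-ordered : ∀ i {j₁ j₂} → j₁ < j₂ → ∀ {k₁ k₂} → k₁ ∈ Act i j₁ → k₂ ∈ Act i j₂ → k₁ < k₂
    act-ordered i {j₁} {j₂} j₁<j₂ {k₁} {k₂} k₁∈ (k₂∈ , _) with view j₁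
    ... | ‵fromℕ     = contradiction (≤fromℕ j₂) (ℕ.<⇒≱ j₁<j₂)
    ... | ‵inject₁ j = ℕ.<-≤-trans (acts-until-force {k = k₁} (proj₂ (forces i j)) k₁∈)
      (≤-trans (times-increase-≤ i {suc j} (inject₁<⇒suc≤ {j = j₂} j₁<j₂)) (∈E⁻ k₂ k₂∈))

    -- Follow the active vertex through time: if it forces in a step, activity passes to its target;
    -- otherwise it remains active.
    act-exists : ∀ i k → ∃[ j ] k ∈ Act i j
    act-exists i = <-weakInduction (λ k → ∃[ j ] k ∈ Act i j)
      (zero , (zero , z≤n , IsChain.starts (chains i)) , λ _ ()) next
      where
      next : ∀ k → ∃[ j ] inject₁ k ∈ Act i j → ∃[ j ] suc k ∈ Act i j
      next k (j , blue , idle) with any? (λ u → F? k (at i j) u)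
      ... | yes (u , f) with position-of-force j f
      ...   | j′ , _ , refl =
        suc j′ , subst (_∈ Act i (suc j′)) (force-time f) (acts-when-blue (at i (suc j′)))
      next k (j , blue , idle) | no idle-now =
        j , E-monotone {inject₁ k} {suc k} (ℕ.<⇒≤ (inject₁<suc k)) blue , still
        where
        still : ∀ l → suc l ≤ suc k → ∀ u → ¬ F l (at i j) u
        still l l≤k u f with l ≟ k
        ... | yes refl = idle-now (u , f)
        ... | no l≢k   = idle l (subst (suc (toℕ l) ℕ.≤_) (sym (toℕ-inject₁ k))
                                  (≤∧≢⇒< (s≤s⁻¹ l≤k) l≢k)) u f

    witness : IsWitness G R K Act
    witness = record
      { blocks = λ i → record
          { nonempty  = λ j → time (at i j) , acts-when-blue (at i j)
          ; partition = λ k → let j , k∈ = act-exists i k in j , k∈ , only i k k∈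
          ; ordered   = act-ordered i
          }
      ; meets = meets
      }
      where
      only : ∀ i k {j j′} → k ∈ Act i j → k ∈ Act i j′ → j ≡ j′
      only i k {j} {j′} k∈ k∈′ with <-cmp j j′
      ... | tri< lt _ _ = contradiction (act-ordered i lt {k} {k} k∈ k∈′) (<-irrefl refl)
      ... | tri≈ _ eq _ = eq
      ... | tri> _ _ gt = contradiction (act-ordered i gt {k} {k} k∈′ k∈) (<-irrefl refl)

      unforced : ∀ {i₁ i₂} → i₁ ≢ i₂ → ∀ j₁ j₂ k → ¬ F k (at i₁ j₁) (at i₂ j₂)
      unforced i₁≢i₂ j₁ j₂ k f with j , _ , eq ← position-of-force j₁ f =
        i₁≢i₂ (sym (same-chain j₂ (suc j) eq))

      meets : ∀ {i₁ i₂} → i₁ ≢ i₂ → ∀ j₁ j₂ → Adj (at i₁ j₁) (at i₂ j₂) → Act i₁ j₁ ≬ Act i₂ j₂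
      -- The common time is the later of the two times at which the endpoints turn blue.
      meets {i₁} {i₂} i₁≢i₂ j₁ j₂ adj with ≤-total (time (at i₁ j₁)) (time (at i₂ j₂))
      ... | inj₁ le = time (at i₂ j₂) ,
        acts-at-later-blue adj (unforced i₁≢i₂ j₁ j₂) le , acts-when-blue _
      ... | inj₂ ge = time (at i₁ j₁) , acts-when-blue _ ,
        acts-at-later-blue (symmetric adj) (unforced (i₁≢i₂ ∘ sym) j₂ j₁) ge

-- From a witness to positions on the paths

module FromWitness {n m K : ℕ} (G : Graph n) (Q : Collection n m) (R : Rows n m)
                   (A : (i : Fin m) → Fin (suc (Rows.last R i)) → TimeSet K)
                   (cover : IsPathCover G Q) (labelling : IsLabelling G Q R)
                   (witness : IsWitness G R K A) where
  open Graph G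
  open Rows R
  open IsWitness witness

  located : ∀ x → ∃₂ λ i j → at i j ≡ x
  located x = let i , x∈Q , _ = IsPathCover.covers cover x
                  j , at≡x = proj₁ (IsPathOrder.vertices (labelling i)) x∈Q
              in i , j , at≡x

  same-chain : ∀ {i i′ j j′} → at i j ≡ at i′ j′ → i ≡ i′
  same-chain {i} {i′} {j} {j′} eq =
    let _ , _ , only = IsPathCover.covers cover (at i j)
    in trans (sym (only (member i j refl))) (only (member i′ j′ (sym eq)))
    where
    member : ∀ i j {x} → at i j ≡ x → x ∈ Q i
    member i j at≡x = proj₂ (IsPathOrder.vertices (labelling i)) (j , at≡x)

  at-injective : ∀ {i j j′} → at i j ≡ at i j′ → j ≡ j′
  at-injective {i} = IsPathOrder.injective (labelling i)

  -- The index of the block containing `k`. It will turn out to mark the last blue vertex of path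
  -- `i` at time `k`.
  position : ∀ i → Fin (suc K) → Fin (suc (last i))
  position i k = proj₁ (IsBlockPartition.partition (blocks i) k)

  ∈position : ∀ i k → k ∈ A i (position i k)
  ∈position i k = proj₁ (proj₂ (IsBlockPartition.partition (blocks i) k))

  position-unique : ∀ {i j} k → k ∈ A i j → position i k ≡ j
  position-unique {i} k = proj₂ (proj₂ (IsBlockPartition.partition (blocks i) k))

  reached : ∀ i j → ∃[ k ] position i k ≡ j
  reached i j = let k , k∈ = IsBlockPartition.nonempty (blocks i) j in k , position-unique k k∈

  position-reflects-< : ∀ i {k l} → position i k < position i l → k < l
  position-reflects-< i {k} {l} lt =
    IsBlockPartition.ordered (blocks i) lt (∈position i k) (∈position i l)

  position-monotone : ∀ i {k l} → k ≤ l → position i k ≤ position i l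
  position-monotone i {k} {l} k≤l =
    ℕ.≮⇒≥ λ lt → ℕ.<⇒≱ (position-reflects-< i {l} {k} lt) k≤l

  position-zero : ∀ i → position i zero ≡ zero
  position-zero i = let k , eq = reached i zero in
    ≤-antisym (subst (position i zero ≤_) eq (position-monotone i {zero} {k} z≤n)) z≤n

  ≤position-last : ∀ i j → j ≤ position i (fromℕ K)
  ≤position-last i j = let k , eq = reached i j in
    subst (_≤ position i (fromℕ K)) eq (position-monotone i (≤fromℕ k))

  -- With time k still in block j, time k+1 is the first time of block j+1; this is the step in
  -- which the force will be placed.
  Crosses : ∀ i → Fin (last i) → Fin K → Set
  Crosses i j k = inject₁ k ∈ A i (inject₁ j) × suc k ∈ A i (suc j)

  -- A discrete intermediate value argument: the position starts at zero and skips no index, since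
  -- every block is nonempty.
  crossing : ∀ i j k → suc j ≤ position i k → ∃[ l ] suc l ≤ k × Crosses i j l
  crossing i j = <-weakInduction (λ k → suc j ≤ position i k → ∃[ l ] suc l ≤ k × Crosses i j l)
    base step
    where
    base : suc j ≤ position i zero → ∃[ l ] suc l ≤ zero {n = K} × Crosses i j l
    base le rewrite position-zero i with () ← le

    step : ∀ k → (suc j ≤ position i (inject₁ k) → ∃[ l ] suc l ≤ inject₁ k × Crosses i j l) →
           suc j ≤ position i (suc k) → ∃[ l ] suc l ≤ suc k × Crosses i j l
    step k ih after with suc j ≤? position i (inject₁ k)
    ... | yes p = let l , l<k , c = ih p in
      l , ℕ.≤-trans l<k (ℕ.<⇒≤ (inject₁<suc k)) , c
    ... | no ¬p = k , ℕ.≤-refl ,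
      subst (λ x → inject₁ k ∈ A i x) (≤-antisym before leaves) (∈position i (inject₁ k)) ,
      subst (λ x → suc k ∈ A i x) (≤-antisym enters after) (∈position i (suc k))
      where
      before : position i (inject₁ k) ≤ inject₁ j
      before = <suc⇒≤inject₁ (ℕ.≰⇒> ¬p)

      -- A time in block j precedes k+1, so by time k the position is at least j. Dually, `enters`
      -- uses a time in block j+1, which must come after k.
      leaves : inject₁ j ≤ position i (inject₁ k)
      leaves with reached i (inject₁ j)
      ... | l , eq = subst (_≤ position i (inject₁ k)) eq
        (position-monotone i (<suc⇒≤inject₁ (position-reflects-< i {l} {suc k}
          (subst (_< position i (suc k)) (sym eq)
            (suc≤⇒inject₁< {i = j} {j = position i (suc k)} after)))))

      enters : position i (suc k) ≤ suc j
      enters with reached i (suc j)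
      ... | l , eq = subst (position i (suc k) ≤_) eq
        (position-monotone i {suc k} {l} (inject₁<⇒suc≤ {j = l} (position-reflects-< i {inject₁ k} {l}
          (subst (position i (inject₁ k) <_) (sym eq) (ℕ.≰⇒> ¬p)))))

  -- The chronology defined by a witness

  F : ForceFamily n K
  F k v u = ∃₂ λ i j → at i (inject₁ j) ≡ v × at i (suc j) ≡ u × Crosses i j k

  E : Fin (suc K) → VertexSet n
  E = E[_] (starts R) F

  -- With `∈E⁻`, this makes the blue part of path `i` at time `k` the initial segment ending at
  -- `position i k`: starts are blue at once, other vertices from their crossing on.
  ∈E⁺ : ∀ {i} j {k} → j ≤ position i k → at i j ∈ E k
  ∈E⁺ {i} zero    _  = zero , z≤n , i , refl
  ∈E⁺ {i} (suc j) {k} le = let l , l<k , c = crossing i j k le in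
    suc l , l<k , at i (inject₁ j) , i , j , refl , refl , c

  ∈E⁻ : ∀ {i j} k → at i j ∈ E k → j ≤ position i k
  ∈E⁻ k (zero , _ , i′ , eq) with same-chain eq
  ... | refl with refl ← at-injective eq = z≤n
  ∈E⁻ {i} k (suc l , l<k , _ , i′ , j′ , _ , eq , _ , entered) with same-chain eq
  ... | refl with refl ← at-injective eq =
    subst (_≤ position i k) (position-unique (suc l) entered) (position-monotone i {suc l} {k} l<k)

  -- The two blocks share a time `t`. It precedes the first time k+1 of the next block on path `i`,
  -- so path `i′` has reached `j′` by time k.
  adjacent⇒blue : ∀ {i i′ j′ k} j → i ≢ i′ → Crosses i j k →
    Adj (at i (inject₁ j)) (at i′ j′) → at i′ j′ ∈ E (inject₁ k)
  adjacent⇒blue {i} {i′} {j′} {k} j i≢i′ (_ , entered) adj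
    with meets i≢i′ (inject₁ j) j′ adj
  ... | t , t∈ , t∈′ = ∈E⁺ j′ (subst (_≤ position i′ (inject₁ k)) (position-unique t t∈′)
    (position-monotone i′ (<suc⇒≤inject₁ (position-reflects-< i {t} {suc k}
      (subst₂ _<_ (sym (position-unique t t∈)) (sym (position-unique (suc k) entered))
        (inject₁<suc j))))))

  successor : ∀ {N} {j : Fin N} {j′ : Fin (suc N)} →
    inject₁ j < j′ → ∣ toℕ (inject₁ j) - toℕ j′ ∣ ≡ 1 → j′ ≡ suc j
  successor {j = j} {j′} lt d =
    toℕ-injective (trans (distance-one lt d) (cong suc (toℕ-inject₁ j)))

  chronology : IsRelaxedChronology G (starts R) F
  chronology = record { valid = valid ; unique = unique ; full = full }
    where
    valid : ∀ k {v u} → F k v u → S G (E (inject₁ k)) v u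
    valid k (i , j , refl , refl , c@(left , entered)) = record
      { blue     = ∈E⁺ (inject₁ j) (≤-reflexive (sym now))
      ; adjacent = Equivalence.from (IsPathOrder.adjacency (labelling i) (inject₁ j) (suc j))
                     (successive (cong suc (sym (toℕ-inject₁ j))))
      ; white    = λ u∈ → ℕ.<⇒≱ (inject₁<suc j)
                     (subst (suc j ≤_) now (∈E⁻ (inject₁ k) u∈))
      ; only     = only
      }
      where
      now : position i (inject₁ k) ≡ inject₁ j
      now = position-unique (inject₁ k) left

      -- Neighbors on other paths are blue, and so are vertices of path `i` up to `j`; beyond `j`,
      -- inducedness leaves only the successor.
      only : ∀ w → Adj (at i (inject₁ j)) w → ¬ (w ∈ E (inject₁ k)) → w ≡ at i (suc j)
      only w adj w∉ with located w
      ... | i′ , j′ , refl with i ≟ i′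
      ...   | no i≢i′  = contradiction (adjacent⇒blue j i≢i′ c adj) w∉
      ...   | yes refl with j′ ≤? inject₁ j
      ...     | yes le = contradiction (∈E⁺ j′ (subst (j′ ≤_) (sym now) le)) w∉
      ...     | no ¬le = cong (at i) (successor (ℕ.≰⇒> ¬le)
                (Equivalence.to (IsPathOrder.adjacency (labelling i) (inject₁ j) j′) adj))

    unique : ∀ k {v₁ v₂ u} → F k v₁ u → F k v₂ u → v₁ ≡ v₂
    unique k (i , j , refl , refl , _) (i′ , j′ , refl , eq , _) with same-chain eq
    ... | refl with refl ← at-injective eq = refl

    full : ∀ x → x ∈ E (fromℕ K)
    full x with i , j , refl ← located x = ∈E⁺ j (≤position-last i j)

  labelled-chain-set : IsLabelledChainSet (starts R) F Q R
  labelled-chain-set = record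
    { chains   = λ i → record { starts = i , refl ; forces = forces i ; stops = stops i }
    ; one-each = λ { v (i , eq) → i , eq , λ eq′ → same-chain (trans eq (sym eq′)) }
    ; vertices = λ i → IsPathOrder.vertices (labelling i)
    }
    where
    forces : ∀ i j → ∃[ k ] F k (at i (inject₁ j)) (at i (suc j))
    forces i j = let k , _ , c = crossing i j (fromℕ K) (≤position-last i (suc j)) in
      k , i , j , refl , refl , c

    stops : ∀ i k u → ¬ F k (at i (fromℕ (last i))) u
    stops i k u (i′ , j′ , eq , _) with same-chain eq
    ... | refl = fromℕ≢inject₁ (sym (at-injective eq))

  -- Being blue means that the position has reached `j`, and having performed no force means that it
  -- has not passed `j`; together they say that `k` lies in block `j`.
  A≐act : ∀ i j → A i j ≐ act (starts R) F (at i j)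
  A≐act i j = (λ {k} → to k) , (λ {k} → from k)
    where
    to : ∀ k → k ∈ A i j → k ∈ act (starts R) F (at i j)
    to k k∈ = ∈E⁺ j (≤-reflexive (sym (position-unique k k∈))) , idle
      where
      idle : ∀ l → suc l ≤ k → ∀ u → ¬ F l (at i j) u
      idle l l<k u (i′ , j′ , eq , _ , _ , entered) with same-chain eq
      ... | refl with refl ← at-injective eq = ℕ.<⇒≱ (inject₁<suc j′)
        (subst₂ _≤_ (position-unique (suc l) entered) (position-unique k k∈)
          (position-monotone i {suc l} {k} l<k))

    from : ∀ k → k ∈ act (starts R) F (at i j) → k ∈ A i j
    from k (blue , idle) = subst (λ x → k ∈ A i x) (≤-antisym (not-passed (view j) refl) (∈E⁻ k blue))
                             (∈position i k)
      where
      -- The last index cannot be passed. Passing any other index requires a crossing, hence a force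
      -- that contradicts `idle`.
      not-passed : ∀ {j′} → View j′ → j′ ≡ j → position i k ≤ j
      not-passed ‵fromℕ refl = ≤fromℕ _
      not-passed (‵inject₁ j₁) refl = <suc⇒≤inject₁ (ℕ.≰⇒> λ le →
        let l , l<k , c = crossing i j₁ k le in idle l l<k _ (i , j₁ , refl , refl , c))

-- Combining both directions

theorem3p8 : ∀ {n : ℕ} (G : Graph n) →
    (∀ {m : ℕ} (Q : Collection n m) →
    IsPIP G Q ⇔
    (Σ[ B ∈ VertexSet n ] ∃[ K ] Σ[ F ∈ ForceFamily n K ]
    (IsZeroForcing G B × IsRelaxedChronology G B F × IsChainSet B F Q)))
    ×
    (∀ {m : ℕ} (Q : Collection n m) (R : Rows n m) (K : ℕ)
    (A : (i : Fin m) → Fin (suc (Rows.last R i)) → TimeSet K) →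
    IsPathCover G Q → IsLabelling G Q R → IsWitness G R K A →
    IsZeroForcing G (starts R) ×
    (Σ[ F ∈ ForceFamily n K ]
    (IsRelaxedChronology G (starts R) F ×
    IsLabelledChainSet (starts R) F Q R ×
    (∀ i j → A i j ≐ act (starts R) F (Rows.at R i j)))))
    ×
    (∀ (B : VertexSet n) (K : ℕ) (F : ForceFamily n K) →
    IsZeroForcing G B → IsRelaxedChronology G B F →
    (∃[ m ] Σ[ Q ∈ Collection n m ] IsChainSet B F Q) ×
    (∀ {m : ℕ} (Q : Collection n m) (R : Rows n m) →
    IsLabelledChainSet B F Q R →
    IsPathCover G Q × IsLabelling G Q R ×
    IsWitness G R K (λ i j → act B F (Rows.at R i j))))
theorem3p8 {n} G = correspondence , from-witness , from-chronology
  where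
  from-witness : ∀ {m} (Q : Collection n m) (R : Rows n m) (K : ℕ)
    (A : (i : Fin m) → Fin (suc (Rows.last R i)) → TimeSet K) →
    IsPathCover G Q → IsLabelling G Q R → IsWitness G R K A →
    IsZeroForcing G (starts R) ×
    (Σ[ F ∈ ForceFamily n K ]
      (IsRelaxedChronology G (starts R) F ×
       IsLabelledChainSet (starts R) F Q R ×
       (∀ i j → A i j ≐ act (starts R) F (Rows.at R i j))))
  from-witness Q R K A cover labelling witness =
    FromChronology.zero-forcing G (starts R) W.F W.chronology ,
    W.F , W.chronology , W.labelled-chain-set , W.A≐act
    where module W = FromWitness G Q R A cover labelling witness

  from-chronology : ∀ (B : VertexSet n) (K : ℕ) (F : ForceFamily n K) →
    IsZeroForcing G B → IsRelaxedChronology G B F →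
    (∃[ m ] Σ[ Q ∈ Collection n m ] IsChainSet B F Q) ×
    (∀ {m : ℕ} (Q : Collection n m) (R : Rows n m) →
      IsLabelledChainSet B F Q R →
      IsPathCover G Q × IsLabelling G Q R ×
      IsWitness G R K (λ i j → act B F (Rows.at R i j)))
  from-chronology B K F _ chronology = C.chain-set , λ Q R labelled →
    C.Chains.path-cover Q R labelled , C.Chains.labelling Q R labelled ,
    C.Chains.witness Q R labelled
    where module C = FromChronology G B F chronology

  correspondence : ∀ {m} (Q : Collection n m) → IsPIP G Q ⇔
    (Σ[ B ∈ VertexSet n ] ∃[ K ] Σ[ F ∈ ForceFamily n K ]
      (IsZeroForcing G B × IsRelaxedChronology G B F × IsChainSet B F Q))
  correspondence Q = mk⇔
    (λ (cover , R , labelling , K , A , witness) →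
      let zf , F , chronology , labelled , _ = from-witness Q R K A cover labelling witness
      in starts R , K , F , zf , chronology , R , labelled)
    (λ (B , K , F , zf , chronology , R , labelled) →
      let cover , labelling , witness = proj₂ (from-chronology B K F zf chronology) Q R labelled
      -- The block partitions left to inference are the active times, fixed by the type of
      -- `witness`.
      in cover , R , labelling , K , _ , witness)
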